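{- Let $k \geq 2$, let $n_1,\ldots,n_k$ be positive integers and let $q$ be a positive integer. Assume that $G=K_{n_1,\ldots,n_k}$ has an equitable $q$-coloring. Then $p(q: n_1,\ldots,n_k)$ is the minimum $p$ such that $G$ has an equitable $r$-coloring for each integer $r$ satisfying $p \leq r \leq q$ (the minimum being over positive integers $p \le q$).
   Context: All graphs are finite, undirected and simple. $K_{n_1,\ldots,n_k}$ denotes the complete $k$-partite graph whose partite sets $X_1,\ldots,X_k$ have sizes $|X_i|=n_i$ for $1\le i\le k$ (two vertices are adjacent if and only if they lie in different partite sets). An equitable $q$-coloring of a graph is a proper vertex coloring with $q$ colors such that the sizes of every two of the $q$ color classes differ by at most $1$. Definition of $p(q: n_1,\ldots,n_k)$: assume that $K_{n_1,\ldots,n_k}$ has an equitable $q$-coloring. Let $d$ be the minimum integer with $d \geq \lceil (n_1+\cdots+n_k)/q \rceil$ such that at least one of the following holds: (i) there are distinct indices $i$ and $j$ such that neither $n_i$ nor $n_j$ is divisible by $d$; or (ii) there is an index $j$ with $n_j/\lfloor n_j/d\rfloor > d+1$, where the quotient is a real (rational) quotient, and is read as $+\infty$ when $\lfloor n_j/d\rfloor = 0$ (so (ii) holds whenever $d>n_j$ for some $j$). Then $p(q: n_1,\ldots,n_k) = \lceil n_1/d \rceil+\cdots+\lceil n_k/d \rceil$. -}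

module Defs where

import Algebra.Properties.CommutativeMonoid.Sum
open import Data.Empty using (⊥-elim)
open import Data.Fin using (Fin; zero)
import Data.Fin.Properties as Fin
import Data.Integer as ℤ
open import Data.List using (List; length; filter; map; concat; allFin)
open import Data.List.Membership.Propositional using (_∈_)
open import Data.List.Membership.Propositional.Properties
  using (∈-map⁺; ∈-map⁻; ∈-allFin; ∈-concat⁺′)
import Data.List.Relation.Unary.All as All
import Data.List.Relation.Unary.All.Properties as All
import Data.List.Relation.Unary.AllPairs as AllPairs
import Data.List.Relation.Unary.AllPairs.Properties as AllPairs
open import Data.List.Relation.Unary.Unique.Propositional using (Unique)
import Data.List.Relation.Unary.Unique.Propositional.Properties as Unique
open import Data.Nat
  using (ℕ; zero; suc; pred; _+_; _⊔_; _≤_; _<_; z≤n; s≤s; ∣_-_∣; _/_; NonZero; NonTrivial)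
open import Data.Nat.Divisibility using (_∣_; _∣?_)
open import Data.Nat.DivMod using (m<n⇒m/n≡0)
open import Data.Nat.Properties
  using (+-0-commutativeMonoid; _≤?_; m≤m⊔n; m≤n⊔m; m≤n⇒m≤1+n)
open import Data.Product using (Σ; ∃; ∃₂; _×_; _,_; proj₁; proj₂)
import Data.Rational.Unnormalised as ℚᵘ
import Data.Rational.Unnormalised.Properties as ℚᵘ
open import Data.Sum using (_⊎_; inj₁; inj₂)
open import Data.Unit using (⊤; tt)
open import Function using (_∘_)
open import Relation.Binary using (Symmetric; Irreflexive)
open import Relation.Binary.PropositionalEquality using (_≡_; _≢_; refl; sym; subst)
open import Relation.Nullary using (Dec; yes; no; ¬_; ¬?; _×-dec_; _⊎-dec_)
open import Relation.Unary using (Pred; Decidable)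

private
  module ∑ = Algebra.Properties.CommutativeMonoid.Sum +-0-commutativeMonoid

sum : ∀ {k} → (Fin k → ℕ) → ℕ
sum = ∑.sum

record FiniteSimpleGraph : Set₁ where
  field
    Vertex            : Set
    _~_               : Vertex → Vertex → Set
    ~-symmetric       : Symmetric _~_
    ~-irreflexive     : Irreflexive _≡_ _~_
    vertices          : List Vertex
    vertices-unique   : Unique vertices
    vertices-complete : ∀ v → v ∈ vertices

module _ (G : FiniteSimpleGraph) where
  open FiniteSimpleGraph G

  Proper : ∀ {q} → (Vertex → Fin q) → Set
  Proper c = ∀ {u v} → u ~ v → c u ≢ c v

  classSize : ∀ {q} → (Vertex → Fin q) → Fin q → ℕ
  classSize c a = length (filter (λ v → c v Fin.≟ a) vertices)

  -- Colour classes may be empty, so q may exceed the number of vertices.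
  record EquitableColoring (q : ℕ) : Set where
    field
      color     : Vertex → Fin q
      proper    : Proper color
      equitable : ∀ a b → ∣ classSize color a - classSize color b ∣ ≤ 1

-- The vertex (i , x) is the x-th element of the partite set Xᵢ.
completeMultipartite : ∀ {k} → (Fin k → ℕ) → FiniteSimpleGraph
completeMultipartite {k} n = record
  { Vertex            = V
  ; _~_               = λ u v → proj₁ u ≢ proj₁ v
  ; ~-symmetric       = λ u≁v → u≁v ∘ sym
  ; ~-irreflexive     = λ { refl u≁u → u≁u refl }
  ; vertices          = concat (map part (allFin k))
  ; vertices-unique   = Unique.concat⁺
      (All.map⁺ (All.universal part-unique (allFin k)))
      (AllPairs.map⁺ (AllPairs.map disjoint (Unique.allFin⁺ k)))
  ; vertices-complete = λ { (i , x) →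
      ∈-concat⁺′ (∈-map⁺ (i ,_) (∈-allFin x)) (∈-map⁺ part (∈-allFin i)) }
  }
  where
  V : Set
  V = Σ (Fin k) (Fin ∘ n)

  part : Fin k → List V
  part i = map (i ,_) (allFin (n i))

  part-unique : ∀ i → Unique (part i)
  part-unique i = Unique.map⁺ (λ { refl → refl }) (Unique.allFin⁺ (n i))

  disjoint : ∀ {i j} → i ≢ j → ∀ {v} → ¬ (v ∈ part i × v ∈ part j)
  disjoint {i} {j} i≢j (v∈i , v∈j) with ∈-map⁻ (i ,_) v∈i | ∈-map⁻ (j ,_) v∈j
  ... | _ , _ , refl | _ , _ , refl = i≢j refl

IsLeast : ∀ {ℓ} → Pred ℕ ℓ → Pred ℕ ℓ
IsLeast P m = P m × (∀ m′ → P m′ → m ≤ m′)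

least : ∀ {ℓ} {P : Pred ℕ ℓ} → Decidable P → ∃ P → ∃ (IsLeast P)
least P? (m , Pm) = search P? m Pm
  where
  search : ∀ {ℓ} {P : Pred ℕ ℓ} → Decidable P → ∀ m → P m → ∃ (IsLeast P)
  search P? zero    P0 = 0 , P0 , λ _ _ → z≤n
  search P? (suc m) Pm with P? 0
  ... | yes P0 = 0 , P0 , λ _ _ → z≤n
  ... | no ¬P0 with search (P? ∘ suc) m Pm
  ...   | l , Pl , l-least = suc l , Pl , λ where
          zero    P0 → ⊥-elim (¬P0 P0)
          (suc x) Px → s≤s (l-least x Px)

⌈_/_⌉ : (m d : ℕ) .{{_ : NonZero d}} → ℕ
⌈ m / d ⌉ = (m + pred d) / d

-- a / f > b as rationals, where a / 0 is read as +∞.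
QuotientExceeds : (a f b : ℕ) → Set
QuotientExceeds a zero    b = ⊤
QuotientExceeds a (suc f) b = ((ℤ.+ a) ℚᵘ./ suc f) ℚᵘ.> ((ℤ.+ b) ℚᵘ./ 1)

module _ {k : ℕ} (n : Fin k → ℕ) where

  TwoNonMultiples : ℕ → Set
  TwoNonMultiples d = ∃₂ λ i j → i ≢ j × ¬ d ∣ n i × ¬ d ∣ n j

  LargeQuotient : (d : ℕ) .{{_ : NonZero d}} → Set
  LargeQuotient d = ∃ λ j → QuotientExceeds (n j) (n j / d) (d + 1)

  -- When the nᵢ are positive, ⌈ sum n / q ⌉ ≤ d already forces d ≢ 0; the
  -- first component only makes the divisions by d well-formed.
  Threshold : (q : ℕ) .{{_ : NonZero q}} → ℕ → Set
  Threshold q d = Σ (NonZero d) λ d≢0 →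
    ⌈ sum n / q ⌉ ≤ d × (TwoNonMultiples d ⊎ LargeQuotient d {{d≢0}})

quotientExceeds? : ∀ a f b → Dec (QuotientExceeds a f b)
quotientExceeds? a zero    b = yes tt
quotientExceeds? a (suc f) b = ((ℤ.+ b) ℚᵘ./ 1) ℚᵘ.<? ((ℤ.+ a) ℚᵘ./ suc f)

threshold? : ∀ {k} (n : Fin k → ℕ) q .{{_ : NonZero q}} → Decidable (Threshold n q)
threshold? n q zero    = no λ ()
threshold? n q (suc d) with ⌈ sum n / q ⌉ ≤? suc d ×-dec
  (Fin.any? (λ i → Fin.any? λ j →
      ¬? (i Fin.≟ j) ×-dec ¬? (suc d ∣? n i) ×-dec ¬? (suc d ∣? n j))
    ⊎-dec Fin.any? (λ j → quotientExceeds? (n j) (n j / suc d) (suc d + 1)))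
... | yes h = yes (_ , h)
... | no ¬h = no λ { (_ , h) → ¬h h }

threshold-exists : ∀ {k} .{{_ : NonTrivial k}} (n : Fin k → ℕ) q .{{_ : NonZero q}} →
                   ∃ (Threshold n q)
threshold-exists {suc (suc _)} n q =
  suc D , _ , m≤n⇒m≤1+n (m≤m⊔n _ (n zero)) , inj₂ (zero , exceeds)
  where
  D : ℕ
  D = ⌈ sum n / q ⌉ ⊔ n zero

  exceeds : QuotientExceeds (n zero) (n zero / suc D) (suc D + 1)
  exceeds = subst (λ f → QuotientExceeds (n zero) f (suc D + 1))
                  (sym (m<n⇒m/n≡0 (s≤s (m≤n⊔m ⌈ sum n / q ⌉ (n zero))))) tt

module _ {k : ℕ} .{{_ : NonTrivial k}} (q : ℕ) .{{_ : NonZero q}} (n : Fin k → ℕ) where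

  leastThreshold : ∃ (IsLeast (Threshold n q))
  leastThreshold = least (threshold? n q) (threshold-exists n q)

  d : ℕ
  d = proj₁ leastThreshold

  d≢0 : NonZero d
  d≢0 = proj₁ (proj₁ (proj₂ leastThreshold))

  p : ℕ
  p = sum λ i → ⌈ n i / d ⌉ {{d≢0}}

{-# OPTIONS --safe #-}

-- Splitting each partite set into colour classes of sizes m and m + 1 gives an
-- equitable r-colouring exactly when r = Σ aᵢ for numbers aᵢ of classes with
-- m aᵢ ≤ nᵢ ≤ (m + 1) aᵢ.  For a fixed m for which such aᵢ exist, the possible
-- values of r therefore form the interval from Σ ⌈nᵢ/(m + 1)⌉ to Σ ⌊nᵢ/m⌋.
-- While d is below the threshold, failure of (ii) makes this interval nonempty
-- for m = d, and failure of (i) says Σ ⌈nᵢ/d⌉ ≤ Σ ⌊nᵢ/d⌋ + 1, so that it is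
-- contiguous with the interval for m = d - 1.  At the threshold d, the value
-- Σ ⌈nᵢ/d⌉ - 1 is missed: it is too small for m < d; for m > d every aᵢ is less
-- than ⌈nᵢ/d⌉, which loses at least k ≥ 2; and m = d is excluded by (i) or (ii).
module Submission where

import Algebra.Properties.Semiring.Sum as SemiringSum
open import Defs
open import Data.Bool using (if_then_else_; true; false)
open import Data.Fin using (Fin; zero; suc; toℕ; splitAt; _↑ˡ_; _↑ʳ_)
import Data.Fin.Properties as Fin
import Data.Integer as ℤ
import Data.Integer.Properties as ℤ
open import Data.List using (List; length; filter; map; concat; allFin; tabulate; _++_)
open import Data.List.Properties using (filter-++; length-++; map-tabulate)
open import Data.Nat
open import Data.Nat.Divisibility using (_∣_; _∣?_; divides)
open import Data.Nat.DivMod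
open import Data.Nat.Properties
open import Data.Product using (Σ; ∃; ∃₂; _×_; _,_; proj₁; proj₂)
import Data.Rational.Unnormalised as ℚᵘ
open import Data.Sum using (_⊎_; inj₁; inj₂)
open import Data.Unit using (tt)
open import Function using (_∘_; id)
open import Relation.Binary.Definitions using (tri<; tri≈; tri>)
open import Relation.Binary.PropositionalEquality
open import Relation.Nullary using (Dec; yes; no; ¬_; does; contradiction)
open import Relation.Nullary.Decidable using (decidable-stable)

open SemiringSum +-*-semiring
  using (sum-cong-≗; ∑-comm; *-distribˡ-sum; sum-replicate-zero)

private
  variable
    A B : Set
    k : ℕ
    f g n : Fin k → ℕ

-- Sums over Fin k

sum-mono-≤ : (∀ i → f i ≤ g i) → sum f ≤ sum g
sum-mono-≤ {zero}  f≤g = z≤n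
sum-mono-≤ {suc k} f≤g = +-mono-≤ (f≤g zero) (sum-mono-≤ (f≤g ∘ suc))

sum-mono-< : (∀ i → f i ≤ g i) → ∀ i → f i < g i → sum f < sum g
sum-mono-< f≤g zero    fi<gi = +-mono-<-≤ fi<gi (sum-mono-≤ (f≤g ∘ suc))
sum-mono-< f≤g (suc i) fi<gi = +-mono-≤-< (f≤g zero) (sum-mono-< (f≤g ∘ suc) i fi<gi)

-- Two strict inequalities at different indices each gain one. A gain of two is what rules out sums
-- that differ by exactly one.
sum-mono-<₂ : (∀ i → f i ≤ g i) → ∀ {i j} → i ≢ j → f i < g i → f j < g j →
              2 + sum f ≤ sum g
sum-mono-<₂ f≤g {zero} {zero} i≢j _ _ = contradiction refl i≢j
sum-mono-<₂ {f = f} f≤g {zero} {suc j} _ fi<gi fj<gj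
  rewrite sym (+-suc (suc (f zero)) (sum (f ∘ suc))) =
  +-mono-≤ fi<gi (sum-mono-< (f≤g ∘ suc) j fj<gj)
sum-mono-<₂ {f = f} f≤g {suc i} {zero} _ fi<gi fj<gj
  rewrite sym (+-suc (suc (f zero)) (sum (f ∘ suc))) =
  +-mono-≤ fj<gj (sum-mono-< (f≤g ∘ suc) i fi<gi)
sum-mono-<₂ {f = f} f≤g {suc i} {suc j} i≢j fi<gi fj<gj
  rewrite sym (+-suc (suc (f zero)) (sum (f ∘ suc)))
        | sym (+-suc (f zero) (suc (sum (f ∘ suc)))) =
  +-mono-≤ (f≤g zero) (sum-mono-<₂ (f≤g ∘ suc) (i≢j ∘ cong suc) fi<gi fj<gj)

-- The second hypothesis leaves at most one index at which `f` exceeds `g`, and there the excess is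
-- at most one.
sum≤1+sum : (∀ i → f i ≤ suc (g i)) → (∀ {i j} → i ≢ j → f i ≤ g i ⊎ f j ≤ g j) →
            sum f ≤ suc (sum g)
sum≤1+sum {zero} _ _ = z≤n
sum≤1+sum {suc k} {f} {g} f≤1+g one with f zero ≤? g zero
... | yes f₀≤g₀ = begin
  f zero + sum (f ∘ suc)       ≤⟨ +-mono-≤ f₀≤g₀ (sum≤1+sum (f≤1+g ∘ suc) λ i≢j → one (i≢j ∘ Fin.suc-injective)) ⟩
  g zero + suc (sum (g ∘ suc)) ≡⟨ +-suc _ _ ⟩
  suc (sum g)                  ∎
  where open ≤-Reasoning
... | no f₀≰g₀ = +-mono-≤ (f≤1+g zero) (sum-mono-≤ rest)
  where
  rest : ∀ i → f (suc i) ≤ g (suc i)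
  rest i with one {zero} {suc i} (λ ())
  ... | inj₁ f₀≤g₀ = contradiction f₀≤g₀ f₀≰g₀
  ... | inj₂ f≤g   = f≤g

sum-const : ∀ k c → sum {k} (λ _ → c) ≡ k * c
sum-const zero    c = refl
sum-const (suc k) c = cong (c +_) (sum-const k c)

sum-toℕ-+ : ∀ m n (f : ℕ → ℕ) →
            sum {m + n} (f ∘ toℕ) ≡ sum {m} (f ∘ toℕ) + sum {n} (λ x → f (m + toℕ x))
sum-toℕ-+ zero    n f = refl
sum-toℕ-+ (suc m) n f =
  trans (cong (f 0 +_) (sum-toℕ-+ m n (f ∘ suc))) (sym (+-assoc (f 0) _ _))

-- A discrete intermediate value property, proved greedily: the head takes as much as it can while
-- leaving the tail at least its minimum `sum (f ∘ suc)`.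
sum-between : (∀ i → f i ≤ g i) → ∀ r → sum f ≤ r → r ≤ sum g →
              ∃ λ a → (∀ i → f i ≤ a i) × (∀ i → a i ≤ g i) × sum a ≡ r
sum-between {zero} _ _ _ z≤n = (λ ()) , (λ ()) , (λ ()) , refl
sum-between {suc k} {f} {g} f≤g r Σf≤r r≤Σg =
  let a , f≤a , a≤g , Σa = sum-between (f≤g ∘ suc) (r ∸ a₀) lower upper in
  (λ { zero → a₀ ; (suc i) → a i }) ,
  (λ { zero → ⊓-glb (f≤g zero) (m+n≤o⇒m≤o∸n (f zero) Σf≤r) ; (suc i) → f≤a i }) ,
  (λ { zero → m⊓n≤m (g zero) _ ; (suc i) → a≤g i }) ,
  trans (cong (a₀ +_) Σa) (m+[n∸m]≡n (≤-trans (m⊓n≤n (g zero) _) (m∸n≤m r (sum (f ∘ suc)))))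
  where
  a₀ = g zero ⊓ (r ∸ sum (f ∘ suc))

  lower : sum (f ∘ suc) ≤ r ∸ a₀
  lower = begin
    sum (f ∘ suc)             ≡⟨ m∸[m∸n]≡n (m+n≤o⇒n≤o (f zero) Σf≤r) ⟨
    r ∸ (r ∸ sum (f ∘ suc))   ≤⟨ ∸-monoʳ-≤ r (m⊓n≤n (g zero) _) ⟩
    r ∸ a₀                    ∎
    where open ≤-Reasoning

  upper : r ∸ a₀ ≤ sum (g ∘ suc)
  -- Either the head is at its maximum `g zero`, or the tail is left with exactly its minimum.
  upper with ⊓-sel (g zero) (r ∸ sum (f ∘ suc))
  ... | inj₁ eq rewrite eq = m≤n+o⇒m∸n≤o r (g zero) r≤Σg
  ... | inj₂ eq rewrite eq | m∸[m∸n]≡n (m+n≤o⇒n≤o (f zero) Σf≤r) = sum-mono-≤ (f≤g ∘ suc)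

-- Counting with Iverson brackets

⟦_⟧ : Dec A → ℕ
⟦ A? ⟧ = if does A? then 1 else 0

⟦⟧-true : A → (A? : Dec A) → ⟦ A? ⟧ ≡ 1
⟦⟧-true a (yes _) = refl
⟦⟧-true a (no ¬a) = contradiction a ¬a

⟦⟧-false : ¬ A → (A? : Dec A) → ⟦ A? ⟧ ≡ 0
⟦⟧-false ¬a (yes a) = contradiction a ¬a
⟦⟧-false ¬a (no _)  = refl

⟦⟧-cong : (A → B) → (B → A) → (A? : Dec A) (B? : Dec B) → ⟦ A? ⟧ ≡ ⟦ B? ⟧
⟦⟧-cong to from (yes a) B? = sym (⟦⟧-true (to a) B?)
⟦⟧-cong to from (no ¬a) B? = sym (⟦⟧-false (¬a ∘ from) B?)

sum-select : {P : Fin k → Set} (P? : ∀ i → Dec (P i)) (f : Fin k → ℕ) (j : Fin k) →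
             P j → (∀ i → P i → i ≡ j) → sum (λ i → ⟦ P? i ⟧ * f i) ≡ f j
sum-select {suc k} P? f zero Pj unique = begin
  ⟦ P? zero ⟧ * f zero + sum (λ i → ⟦ P? (suc i) ⟧ * f (suc i))
    ≡⟨ cong₂ _+_ (cong (_* f zero) (⟦⟧-true Pj (P? zero)))
         (trans (sum-cong-≗ λ i → cong (_* f (suc i)) (⟦⟧-false (λ Pi → contradiction (unique (suc i) Pi) λ ()) (P? (suc i))))
                (sum-replicate-zero k)) ⟩
  f zero + 0 + 0 ≡⟨ trans (+-identityʳ _) (+-identityʳ _) ⟩
  f zero         ∎
  where open ≡-Reasoning
sum-select P? f (suc j) Pj unique = cong₂ _+_
  (cong (_* f zero) (⟦⟧-false (λ P0 → contradiction (unique zero P0) λ ()) (P? zero)))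
  (sum-select (P? ∘ suc) (f ∘ suc) j Pj λ i Pi → Fin.suc-injective (unique (suc i) Pi))

sum-unique : {P : Fin k → Set} (P? : ∀ i → Dec (P i)) (j : Fin k) →
             P j → (∀ i → P i → i ≡ j) → sum (λ i → ⟦ P? i ⟧) ≡ 1
sum-unique P? j Pj unique =
  trans (sum-cong-≗ λ i → sym (*-identityʳ ⟦ P? i ⟧)) (sum-select P? (λ _ → 1) j Pj unique)

length-filter-map : ∀ n {P : A → Set} (P? : ∀ v → Dec (P v)) (f : Fin n → A) →
                    length (filter P? (map f (allFin n))) ≡ sum λ x → ⟦ P? (f x) ⟧
-- The list becomes a `tabulate`, which unfolds by recursion on `n`.
length-filter-map n P? f = trans (cong (length ∘ filter P?) (map-tabulate id f)) (go n f)
  where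
  go : ∀ n f → length (filter P? (tabulate {n = n} f)) ≡ sum λ x → ⟦ P? (f x) ⟧
  go zero    f = refl
  go (suc n) f with does (P? (f zero))
  ... | true  = cong suc (go n (f ∘ suc))
  ... | false = go n (f ∘ suc)

length-filter-concat : ∀ k {P : A → Set} (P? : ∀ v → Dec (P v)) (f : Fin k → List A) →
                       length (filter P? (concat (map f (allFin k)))) ≡
                       sum λ i → length (filter P? (f i))
length-filter-concat k P? f =
  trans (cong (length ∘ filter P? ∘ concat) (map-tabulate id f)) (go k f)
  where
  go : ∀ k f → length (filter P? (concat (tabulate {n = k} f))) ≡
               sum λ i → length (filter P? (f i))
  go zero    f = refl
  go (suc k) f = begin
    length (filter P? (f zero ++ rest))
      ≡⟨ cong length (filter-++ P? (f zero) rest) ⟩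
    length (filter P? (f zero) ++ filter P? rest)
      ≡⟨ length-++ (filter P? (f zero)) ⟩
    length (filter P? (f zero)) + length (filter P? rest)
      ≡⟨ cong (length (filter P? (f zero)) +_) (go k (f ∘ suc)) ⟩
    sum (λ i → length (filter P? (f i))) ∎
    where
    open ≡-Reasoning
    rest = concat (tabulate (f ∘ suc))

classSize-sum : ∀ {q} (n : Fin k → ℕ) (color : Σ (Fin k) (Fin ∘ n) → Fin q) c →
                classSize (completeMultipartite n) color c ≡
                sum λ i → sum λ x → ⟦ color (i , x) Fin.≟ c ⟧
classSize-sum {k} n color c = trans
  (length-filter-concat k (λ v → color v Fin.≟ c) (λ i → map (i ,_) (allFin (n i))))
  (sum-cong-≗ λ i → length-filter-map (n i) (λ v → color v Fin.≟ c) (i ,_))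

-- Residue classes in initial segments of ℕ

residueCount : (a n y : ℕ) .{{_ : NonZero a}} → ℕ
residueCount a n y = sum {n} λ x → ⟦ toℕ x % a ≟ y ⟧

residueCount-mono : ∀ {n n′} a y .{{_ : NonZero a}} → n ≤ n′ →
                    residueCount a n y ≤ residueCount a n′ y
residueCount-mono {n} a y n≤n′ with o , refl ← m≤n⇒∃[o]m+o≡n n≤n′
  rewrite sum-toℕ-+ n o (λ x → ⟦ x % a ≟ y ⟧) = m≤m+n _ _

-- The range consists of `t` full periods of length `a`, and each period meets every residue once.
residueCount-* : ∀ t a (y : Fin a) .{{_ : NonZero a}} → residueCount a (t * a) (toℕ y) ≡ t
residueCount-* zero    a y = refl
residueCount-* (suc t) a y = begin
  residueCount a (a + t * a) (toℕ y)
    ≡⟨ sum-toℕ-+ a (t * a) (λ x → ⟦ x % a ≟ toℕ y ⟧) ⟩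
  sum {a} (λ x → ⟦ toℕ x % a ≟ toℕ y ⟧) + sum {t * a} (λ x → ⟦ (a + toℕ x) % a ≟ toℕ y ⟧)
    ≡⟨ cong₂ _+_ (sum-unique (λ x → toℕ x % a ≟ toℕ y) y (small y) unique)
                 (sum-cong-≗ {t * a} λ x → cong (λ z → ⟦ z ≟ toℕ y ⟧) (shift (toℕ x))) ⟩
  1 + residueCount a (t * a) (toℕ y)
    ≡⟨ cong suc (residueCount-* t a y) ⟩
  suc t ∎
  where
  open ≡-Reasoning

  small : ∀ (x : Fin a) → toℕ x % a ≡ toℕ x
  small x = m<n⇒m%n≡m (Fin.toℕ<n x)

  unique : ∀ x → toℕ x % a ≡ toℕ y → x ≡ y
  unique x eq = Fin.toℕ-injective (trans (sym (small x)) eq)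

  shift : ∀ x → (a + x) % a ≡ x % a
  shift x = trans (cong (_% a) (+-comm a x)) ([m+n]%n≡m%n x a)

-- Colourings and splittings

Splits : ℕ → (Fin k → ℕ) → (Fin k → ℕ) → Set
Splits m n a = ∀ i → m * a i ≤ n i × n i ≤ suc m * a i

Split⇒NonZero : ∀ {m a} → (∀ i → 0 < n i) → Splits m n a → ∀ i → NonZero (a i)
Split⇒NonZero {n = n} {m} {a} 0<n split i = ≢-nonZero λ aᵢ≡0 →
  n≮0 (≤-trans (0<n i) (subst (n i ≤_) (trans (cong (suc m *_) aᵢ≡0) (*-zeroʳ m)) (proj₂ (split i))))

-- Numbering the colours in consecutive blocks, one block per partite set

index : (a : Fin k → ℕ) → Σ (Fin k) (Fin ∘ a) → Fin (sum a)
index {suc k} a (zero  , y) = y ↑ˡ _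
index {suc k} a (suc i , y) = a zero ↑ʳ index (a ∘ suc) (i , y)

slot : (a : Fin k → ℕ) → Fin (sum a) → Σ (Fin k) (Fin ∘ a)
slot {suc k} a c with splitAt (a zero) c
... | inj₁ y = zero , y
... | inj₂ z = let i , y = slot (a ∘ suc) z in suc i , y

slot-index : (a : Fin k → ℕ) → ∀ s → slot a (index a s) ≡ s
slot-index {suc k} a (zero , y) rewrite Fin.splitAt-↑ˡ (a zero) y (sum (a ∘ suc)) = refl
slot-index {suc k} a (suc i , y)
  rewrite Fin.splitAt-↑ʳ (a zero) (sum (a ∘ suc)) (index (a ∘ suc) (i , y))
        | slot-index (a ∘ suc) (i , y) = refl

index-slot : (a : Fin k → ℕ) → ∀ c → index a (slot a c) ≡ c
index-slot {suc k} a c with splitAt (a zero) c in eq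
... | inj₁ y = Fin.splitAt⁻¹-↑ˡ eq
... | inj₂ z = trans (cong (a zero ↑ʳ_) (index-slot (a ∘ suc) z)) (Fin.splitAt⁻¹-↑ʳ eq)

index-injective : (a : Fin k → ℕ) → ∀ {s t} → index a s ≡ index a t → s ≡ t
index-injective a {s} {t} eq =
  trans (sym (slot-index a s)) (trans (cong (slot a) eq) (slot-index a t))

∣-∣≤1 : ∀ {m x y} → m ≤ x → x ≤ suc m → m ≤ y → y ≤ suc m → ∣ x - y ∣ ≤ 1
∣-∣≤1 {m} {x} {y} m≤x x≤1+m m≤y y≤1+m with ∣m-n∣≡[m∸n]∨[n∸m] x y
... | inj₁ eq rewrite eq = m≤n+o⇒m∸n≤o x y (≤-trans x≤1+m (≤-trans (s≤s m≤y) (≤-reflexive (+-comm 1 y))))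
... | inj₂ eq rewrite eq = m≤n+o⇒m∸n≤o y x (≤-trans y≤1+m (≤-trans (s≤s m≤x) (≤-reflexive (+-comm 1 x))))

-- Part `i` is dealt cyclically to its own `a i` colours. A class size is then a residue count,
-- monotone in `n i`; at the bounds `m * a i` and `suc m * a i` it equals `m` and `suc m`.
split⇒coloring : ∀ m (n a : Fin k → ℕ) → (∀ i → 0 < n i) → Splits m n a →
                 EquitableColoring (completeMultipartite n) (sum a)
split⇒coloring {k} m n a 0<n split = record
  { color     = color
  ; proper    = λ u≁v eq → u≁v (cong proj₁ (index-injective a eq))
  ; equitable = λ b c → ∣-∣≤1 (lower b) (upper b) (lower c) (upper c)
  }
  where
  instance
    a≢0 : ∀ {i} → NonZero (a i)
    a≢0 {i} = Split⇒NonZero {m = m} {a} 0<n split i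

  vertexSlot : Σ (Fin k) (Fin ∘ n) → Σ (Fin k) (Fin ∘ a)
  vertexSlot (i , x) = i , toℕ x mod a i

  color : Σ (Fin k) (Fin ∘ n) → Fin (sum a)
  color = index a ∘ vertexSlot

  size : Fin (sum a) → ℕ
  size = classSize (completeMultipartite n) color

  -- A colour from block `i` occurs only in part `i`, so the sum over parts collapses to one term.
  size-index : ∀ i y → size (index a (i , y)) ≡ residueCount (a i) (n i) (toℕ y)
  size-index i y = begin
    size (index a (i , y))
      ≡⟨ classSize-sum n color (index a (i , y)) ⟩
    sum hits
      ≡⟨ sum-cong-≗ select ⟩
    sum (λ j → ⟦ j Fin.≟ i ⟧ * hits j)
      ≡⟨ sum-select (Fin._≟ i) hits i refl (λ _ → id) ⟩
    hits i
      ≡⟨ sum-cong-≗ (λ x → ⟦⟧-cong (to x) (from x) (color (i , x) Fin.≟ _) (toℕ x % a i ≟ toℕ y)) ⟩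
    residueCount (a i) (n i) (toℕ y) ∎
    where
    open ≡-Reasoning

    hits : Fin k → ℕ
    hits j = sum λ x → ⟦ color (j , x) Fin.≟ index a (i , y) ⟧

    select : ∀ j → hits j ≡ ⟦ j Fin.≟ i ⟧ * hits j
    select j with j Fin.≟ i
    ... | yes _  = sym (+-identityʳ _)
    ... | no j≢i = trans
      (sum-cong-≗ λ x → ⟦⟧-false (j≢i ∘ cong proj₁ ∘ index-injective a) (color (j , x) Fin.≟ _))
      (sum-replicate-zero (n j))

    toℕ-mod : ∀ (x : Fin (n i)) → toℕ (toℕ x mod a i) ≡ toℕ x % a i
    toℕ-mod x = Fin.toℕ-fromℕ< (m%n<n (toℕ x) (a i))

    to : ∀ x → color (i , x) ≡ index a (i , y) → toℕ x % a i ≡ toℕ y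
    to x eq with index-injective a eq
    ... | refl = sym (toℕ-mod x)

    from : ∀ x → toℕ x % a i ≡ toℕ y → color (i , x) ≡ index a (i , y)
    from x eq = cong (λ z → index a (i , z)) (Fin.toℕ-injective (trans (toℕ-mod x) eq))

  size≡ : ∀ c → let i , y = slot a c in size c ≡ residueCount (a i) (n i) (toℕ y)
  size≡ c = trans (cong size (sym (index-slot a c))) (size-index _ _)

  lower : ∀ c → m ≤ size c
  lower c = let i , y = slot a c in begin
    m                                      ≡⟨ residueCount-* m (a i) y ⟨
    residueCount (a i) (m * a i) (toℕ y)   ≤⟨ residueCount-mono (a i) (toℕ y) (proj₁ (split i)) ⟩
    residueCount (a i) (n i) (toℕ y)       ≡⟨ size≡ c ⟨
    size c                                 ∎
    where open ≤-Reasoning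

  upper : ∀ c → size c ≤ suc m
  upper c = let i , y = slot a c in begin
    size c                                   ≡⟨ size≡ c ⟩
    residueCount (a i) (n i) (toℕ y)         ≤⟨ residueCount-mono (a i) (toℕ y) (proj₂ (split i)) ⟩
    residueCount (a i) (suc m * a i) (toℕ y) ≡⟨ residueCount-* (suc m) (a i) y ⟩
    suc m                                    ∎
    where open ≤-Reasoning

-- From colourings to splittings

equitable⇒bounds : ∀ {q} .{{_ : NonZero q}} (s : Fin q → ℕ) → (∀ b c → ∣ s b - s c ∣ ≤ 1) →
                   ∃ λ m → ∀ c → m ≤ s c × s c ≤ suc m
equitable⇒bounds {suc q} s close with Fin.any? (λ c → s c <? s zero)
-- A class smaller than class `zero` is already a smallest one, since `s zero` exceeds no size by
-- more than 1.
... | yes (b , sb<s0) = s b , λ c → s≤s⁻¹ (≤-trans sb<s0 (step zero c)) , step c b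
  where
  step : ∀ b c → s b ≤ suc (s c)
  step b c = ≤-trans (m≤n+m∸n (s b) (s c))
    (≤-trans (+-monoʳ-≤ (s c) (≤-trans (m∸n≤∣m-n∣ (s b) (s c)) (close b c)))
             (≤-reflexive (+-comm (s c) 1)))
... | no ∄< = s zero , λ c → ≮⇒≥ (λ sc<s0 → ∄< (c , sc<s0)) , ≤-trans (m≤n+m∸n (s c) (s zero))
    (≤-trans (+-monoʳ-≤ (s zero) (≤-trans (m∸n≤∣m-n∣ (s c) (s zero)) (close c zero)))
             (≤-reflexive (+-comm (s zero) 1)))

-- By properness each nonempty class lies in a single part, its owner. With `a i` the number of
-- classes owned by `i`, the owned sizes add up to `n i`, and each lies between `m` and `suc m`.
coloring⇒split : ∀ {r} .{{_ : NonZero r}} → Fin k → (n : Fin k → ℕ) →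
                 EquitableColoring (completeMultipartite n) r →
                 ∃₂ λ m a → Splits m n a × sum a ≡ r
coloring⇒split {k} {r} i₀ n coloring = m , a , split , sum-a
  where
  open EquitableColoring coloring

  size : Fin r → ℕ
  size = classSize (completeMultipartite n) color

  m : ℕ
  m = proj₁ (equitable⇒bounds size equitable)

  m≤size≤1+m : ∀ c → m ≤ size c × size c ≤ suc m
  m≤size≤1+m = proj₂ (equitable⇒bounds size equitable)

  occurs? : ∀ c → Dec (∃₂ λ i x → color (i , x) ≡ c)
  occurs? c = Fin.any? λ i → Fin.any? λ x → color (i , x) Fin.≟ c

  -- Empty colour classes are attributed to the part i₀.
  owner : Fin r → Fin k
  owner c with occurs? c
  ... | yes (i , _) = i
  ... | no _        = i₀

  owner-color : ∀ i x → owner (color (i , x)) ≡ i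
  owner-color i x with occurs? (color (i , x))
  ... | yes (j , y , eq) = decidable-stable (j Fin.≟ i) λ j≢i → proper j≢i eq
  ... | no ∄             = contradiction (i , x , refl) ∄

  a : Fin k → ℕ
  a i = sum λ c → ⟦ owner c Fin.≟ i ⟧

  sum-a : sum a ≡ r
  sum-a = begin
    sum (λ i → sum λ c → ⟦ owner c Fin.≟ i ⟧)
      ≡⟨ ∑-comm (λ i c → ⟦ owner c Fin.≟ i ⟧) ⟩
    sum (λ c → sum λ i → ⟦ owner c Fin.≟ i ⟧)
      ≡⟨ sum-cong-≗ (λ c → sum-unique (owner c Fin.≟_) (owner c) refl (λ _ → sym)) ⟩
    sum {r} (λ _ → 1)
      ≡⟨ trans (sum-const r 1) (*-identityʳ r) ⟩
    r ∎
    where open ≡-Reasoning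

  -- Double counting: after exchanging the sums, each vertex is counted once, at its own colour, and
  -- only if that colour is owned by `i`.
  owned-size : ∀ i → sum (λ c → ⟦ owner c Fin.≟ i ⟧ * size c) ≡ n i
  owned-size i = begin
    sum (λ c → ⟦ owner c Fin.≟ i ⟧ * size c)
      ≡⟨ sum-cong-≗ (λ c → trans (cong (⟦ owner c Fin.≟ i ⟧ *_) (classSize-sum n color c))
           (trans (*-distribˡ-sum ⟦ owner c Fin.≟ i ⟧ (λ j → sum λ x → ⟦ color (j , x) Fin.≟ c ⟧))
                  (sum-cong-≗ λ j → *-distribˡ-sum ⟦ owner c Fin.≟ i ⟧ (λ x → ⟦ color (j , x) Fin.≟ c ⟧)))) ⟩
    sum (λ c → sum λ j → sum λ x → ⟦ owner c Fin.≟ i ⟧ * ⟦ color (j , x) Fin.≟ c ⟧)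
      ≡⟨ ∑-comm (λ c j → sum λ x → ⟦ owner c Fin.≟ i ⟧ * ⟦ color (j , x) Fin.≟ c ⟧) ⟩
    sum (λ j → sum λ c → sum λ x → ⟦ owner c Fin.≟ i ⟧ * ⟦ color (j , x) Fin.≟ c ⟧)
      ≡⟨ sum-cong-≗ (λ j → trans
           (∑-comm (λ c x → ⟦ owner c Fin.≟ i ⟧ * ⟦ color (j , x) Fin.≟ c ⟧))
           (sum-cong-≗ (vertex j))) ⟩
    sum (λ j → sum {n j} λ _ → ⟦ j Fin.≟ i ⟧)
      ≡⟨ sum-cong-≗ (λ j → trans (sum-const (n j) ⟦ j Fin.≟ i ⟧) (*-comm (n j) _)) ⟩
    sum (λ j → ⟦ j Fin.≟ i ⟧ * n j)
      ≡⟨ sum-select (Fin._≟ i) n i refl (λ _ → id) ⟩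
    n i ∎
    where
    open ≡-Reasoning
    vertex : ∀ j x → sum (λ c → ⟦ owner c Fin.≟ i ⟧ * ⟦ color (j , x) Fin.≟ c ⟧) ≡ ⟦ j Fin.≟ i ⟧
    vertex j x = begin
      sum (λ c → ⟦ owner c Fin.≟ i ⟧ * ⟦ color (j , x) Fin.≟ c ⟧)
        ≡⟨ sum-cong-≗ (λ c → *-comm ⟦ owner c Fin.≟ i ⟧ _) ⟩
      sum (λ c → ⟦ color (j , x) Fin.≟ c ⟧ * ⟦ owner c Fin.≟ i ⟧)
        ≡⟨ sum-select (color (j , x) Fin.≟_) (λ c → ⟦ owner c Fin.≟ i ⟧) (color (j , x)) refl (λ _ → sym) ⟩
      ⟦ owner (color (j , x)) Fin.≟ i ⟧
        ≡⟨ cong (λ z → ⟦ z Fin.≟ i ⟧) (owner-color j x) ⟩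
      ⟦ j Fin.≟ i ⟧ ∎

  split : Splits m n a
  split i =
    (begin
      m * a i                                  ≡⟨ *-distribˡ-sum m owned ⟩
      sum (λ c → m * owned c)                  ≤⟨ sum-mono-≤ (λ c → ≤-trans (≤-reflexive (*-comm m (owned c))) (*-monoʳ-≤ (owned c) (proj₁ (m≤size≤1+m c)))) ⟩
      sum (λ c → owned c * size c)             ≡⟨ owned-size i ⟩
      n i                                      ∎) ,
    (begin
      n i                                      ≡⟨ owned-size i ⟨
      sum (λ c → owned c * size c)             ≤⟨ sum-mono-≤ (λ c → ≤-trans (*-monoʳ-≤ (owned c) (proj₂ (m≤size≤1+m c))) (≤-reflexive (*-comm (owned c) (suc m)))) ⟩
      sum (λ c → suc m * owned c)              ≡⟨ *-distribˡ-sum (suc m) owned ⟨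
      suc m * a i                              ∎)
    where
    open ≤-Reasoning
    owned : Fin r → ℕ
    owned c = ⟦ owner c Fin.≟ i ⟧

-- Any `a` between `l` and `u` inherits the lower size condition from `u` and the upper one from
-- `l`; such an `a` exists for every total in the interval.
coloring-between : ∀ m (n l u : Fin k → ℕ) → (∀ i → 0 < n i) → (∀ i → l i ≤ u i) →
                   (∀ i → m * u i ≤ n i) → (∀ i → n i ≤ suc m * l i) →
                   ∀ r → sum l ≤ r → r ≤ sum u → EquitableColoring (completeMultipartite n) r
coloring-between m n l u 0<n l≤u mu≤n n≤ml r Σl≤r r≤Σu =
  let a , l≤a , a≤u , Σa≡r = sum-between l≤u r Σl≤r r≤Σu in
  subst (EquitableColoring (completeMultipartite n)) Σa≡r
    (split⇒coloring m n a 0<n λ i →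
      ≤-trans (*-monoʳ-≤ m (a≤u i)) (mu≤n i) ,
      ≤-trans (n≤ml i) (*-monoʳ-≤ (suc m) (l≤a i)))

-- The threshold

-- Together with `⌈m/d⌉≤`, this characterises `⌈ m / d ⌉` as the least `a` with `m ≤ d * a`.
m≤d*⌈m/d⌉ : ∀ m d .{{_ : NonZero d}} → m ≤ d * ⌈ m / d ⌉
m≤d*⌈m/d⌉ m d@(suc e) = +-cancelʳ-≤ e m (d * ⌈ m / d ⌉) (s≤s⁻¹ (begin
  suc (m + e)                     ≡⟨ cong suc (m≡m%n+[m/n]*n (m + e) d) ⟩
  suc ((m + e) % d + ⌈ m / d ⌉ * d) ≤⟨ +-monoˡ-≤ (⌈ m / d ⌉ * d) (m%n<n (m + e) d) ⟩
  d + ⌈ m / d ⌉ * d               ≡⟨ cong (d +_) (*-comm ⌈ m / d ⌉ d) ⟩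
  d + d * ⌈ m / d ⌉               ≡⟨ +-comm d _ ⟩
  d * ⌈ m / d ⌉ + d               ≡⟨ +-suc _ e ⟩
  suc (d * ⌈ m / d ⌉ + e)         ∎))
  where open ≤-Reasoning

⌈m/d⌉≤ : ∀ {m} d a .{{_ : NonZero d}} → m ≤ d * a → ⌈ m / d ⌉ ≤ a
⌈m/d⌉≤ {m} d@(suc e) a m≤da = s≤s⁻¹ (m<n*o⇒m/o<n (begin-strict
  m + e         ≤⟨ +-monoˡ-≤ e m≤da ⟩
  d * a + e     <⟨ +-monoʳ-< (d * a) (n<1+n e) ⟩
  d * a + d     ≡⟨ +-comm (d * a) d ⟩
  d + d * a     ≡⟨ cong (d +_) (*-comm d a) ⟩
  suc a * d     ∎))
  where open ≤-Reasoning

≤m/d : ∀ {m} d a .{{_ : NonZero d}} → d * a ≤ m → a ≤ m / d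
≤m/d {m} d a da≤m = begin
  a          ≡⟨ m*n/n≡m a d ⟨
  a * d / d  ≤⟨ /-monoˡ-≤ d (≤-trans (≤-reflexive (*-comm a d)) da≤m) ⟩
  m / d      ∎
  where open ≤-Reasoning

d*[m/d]≤m : ∀ m d .{{_ : NonZero d}} → d * (m / d) ≤ m
d*[m/d]≤m m d = ≤-trans (≤-reflexive (*-comm d (m / d))) (m/n*n≤m m d)

-- Clearing denominators; for `f = 0` the convention +∞ agrees with `b * 0 < a` because `a` is
-- positive.
QuotientExceeds⇒< : ∀ {a} f b → 0 < a → QuotientExceeds a f b → b * f < a
QuotientExceeds⇒< {a} zero    b 0<a _ = subst (_< a) (sym (*-zeroʳ b)) 0<a
QuotientExceeds⇒< {a} (suc f) b _ (ℚᵘ.*<* lt) = subst (b * suc f <_) (*-identityʳ a)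
  (ℤ.drop‿+<+ (subst₂ ℤ._<_ (sym (ℤ.pos-* b (suc f))) (sym (ℤ.pos-* a 1)) lt))

<⇒QuotientExceeds : ∀ {a} f b → b * f < a → QuotientExceeds a f b
<⇒QuotientExceeds zero b _ = tt
<⇒QuotientExceeds {a} (suc f) b lt = ℚᵘ.*<* (subst₂ ℤ._<_ (ℤ.pos-* b (suc f)) (ℤ.pos-* a 1)
  (ℤ.+<+ (subst (b * suc f <_) (sym (*-identityʳ a)) lt)))

-- Attained and missed numbers of colours

module _ (n : Fin k → ℕ) (0<n : ∀ i → 0 < n i) where

  threshold⇒gap : (i₀ i₁ : Fin k) → i₀ ≢ i₁ → ∀ d .{{_ : NonZero d}} →
                  TwoNonMultiples n d ⊎ LargeQuotient n d →
                  ∀ m a → Splits m n a → suc (sum a) ≢ sum λ i → ⌈ n i / d ⌉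
  threshold⇒gap i₀ i₁ i₀≢i₁ d th m a split gap with <-cmp m d
  -- Here `suc m ≤ d`, so `n i ≤ d * a i` and each ceiling is at most `a i`: the sum of the `a i` is
  -- already too large.
  ... | tri< m<d _ _ = 1+n≰n (≤-trans (≤-reflexive gap) (sum-mono-≤ λ i →
          ⌈m/d⌉≤ d (a i) (≤-trans (proj₂ (split i)) (*-monoˡ-≤ (a i) m<d))))
  -- Every `a i` falls short of its ceiling, so the two indices `i₀` and `i₁` alone lose two.
  ... | tri> _ _ d<m = 1+n≰n (≤-trans (sum-mono-<₂ (<⇒≤ ∘ a<⌈n/d⌉) i₀≢i₁ (a<⌈n/d⌉ i₀) (a<⌈n/d⌉ i₁))
                                      (≤-reflexive (sym gap)))
    where
    a<⌈n/d⌉ : ∀ i → a i < ⌈ n i / d ⌉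
    a<⌈n/d⌉ i = *-cancelˡ-< d _ _ (begin-strict
      d * a i          <⟨ *-monoˡ-< (a i) {{Split⇒NonZero {m = m} {a} 0<n split i}} d<m ⟩
      m * a i          ≤⟨ proj₁ (split i) ⟩
      n i              ≤⟨ m≤d*⌈m/d⌉ (n i) d ⟩
      d * ⌈ n i / d ⌉  ∎)
      where open ≤-Reasoning
  ... | tri≈ _ refl _ = excluded th
    where
    a≤⌈n/d⌉ : ∀ i → a i ≤ ⌈ n i / d ⌉
    a≤⌈n/d⌉ i = *-cancelˡ-≤ d (≤-trans (proj₁ (split i)) (m≤d*⌈m/d⌉ (n i) d))

    a<⌈n/d⌉ : ∀ i → ¬ d ∣ n i → a i < ⌈ n i / d ⌉
    -- Equality would squeeze `n i` to `d * a i`, a multiple of `d`.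
    a<⌈n/d⌉ i d∤n = ≤∧≢⇒< (a≤⌈n/d⌉ i) λ a≡⌈n/d⌉ → d∤n (divides (a i) (trans
      (≤-antisym (≤-trans (m≤d*⌈m/d⌉ (n i) d) (≤-reflexive (cong (d *_) (sym a≡⌈n/d⌉))))
                 (proj₁ (split i)))
      (*-comm d (a i))))

    excluded : ¬ (TwoNonMultiples n d ⊎ LargeQuotient n d)
    excluded (inj₁ (i , j , i≢j , d∤nᵢ , d∤nⱼ)) = 1+n≰n (≤-trans
      (sum-mono-<₂ a≤⌈n/d⌉ i≢j (a<⌈n/d⌉ i d∤nᵢ) (a<⌈n/d⌉ j d∤nⱼ)) (≤-reflexive (sym gap)))
    -- A splitting into sizes `d` and `suc d` has `a j ≤ n j / d`, hence
    -- `n j ≤ (d + 1) * (n j / d)`, which contradicts (ii).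
    excluded (inj₂ (j , large)) = <-irrefl refl (begin-strict
      (d + 1) * (n j / d)   <⟨ QuotientExceeds⇒< (n j / d) (d + 1) (0<n j) large ⟩
      n j                   ≤⟨ proj₂ (split j) ⟩
      suc d * a j           ≤⟨ *-monoʳ-≤ (suc d) (≤m/d d (a j) (proj₁ (split j))) ⟩
      suc d * (n j / d)     ≡⟨ cong (_* (n j / d)) (+-comm 1 d) ⟩
      (d + 1) * (n j / d)   ∎)
      where open ≤-Reasoning

  module _ (d : ℕ) .{{_ : NonZero d}} where

    -- Ceiling and floor differ by at most one, and agree when `d` divides `n i`; failure of (i)
    -- leaves at most one index where it does not.
    belowThreshold⇒contiguous : ¬ TwoNonMultiples n d →
                                sum (λ i → ⌈ n i / d ⌉) ≤ suc (sum λ i → n i / d)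
    belowThreshold⇒contiguous ¬two = sum≤1+sum ceiling≤ one
      where
      divisible : ∀ i → d ∣ n i → ⌈ n i / d ⌉ ≤ n i / d
      divisible i (divides c eq) = ⌈m/d⌉≤ d (n i / d) (≤-reflexive
        (trans (sym (m/n*n≡m (divides c eq))) (*-comm (n i / d) d)))

      ceiling≤ : ∀ i → ⌈ n i / d ⌉ ≤ suc (n i / d)
      ceiling≤ i = ⌈m/d⌉≤ d (suc (n i / d)) (begin
        n i                           ≡⟨ m≡m%n+[m/n]*n (n i) d ⟩
        n i % d + n i / d * d         ≤⟨ +-monoˡ-≤ _ (m%n≤n (n i) d) ⟩
        suc (n i / d) * d             ≡⟨ *-comm (suc (n i / d)) d ⟩
        d * suc (n i / d)             ∎)
        where open ≤-Reasoning

      one : ∀ {i j} → i ≢ j → ⌈ n i / d ⌉ ≤ n i / d ⊎ ⌈ n j / d ⌉ ≤ n j / d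
      one {i} {j} i≢j with d ∣? n i | d ∣? n j
      ... | yes d∣nᵢ | _        = inj₁ (divisible i d∣nᵢ)
      ... | no _     | yes d∣nⱼ = inj₂ (divisible j d∣nⱼ)
      ... | no d∤nᵢ  | no d∤nⱼ  = contradiction (i , j , i≢j , d∤nᵢ , d∤nⱼ) ¬two

    -- In terms of counts of classes, this says that the least count `⌈ n i / suc d ⌉` does not
    -- exceed the greatest, `n i / d`.
    belowThreshold⇒nonempty : ¬ LargeQuotient n d → ∀ i → n i ≤ suc d * (n i / d)
    belowThreshold⇒nonempty ¬large i = ≮⇒≥ λ lt → ¬large (i , <⇒QuotientExceeds (n i / d) (d + 1)
      (subst (λ z → z * (n i / d) < n i) (+-comm 1 d) lt))

  module _ (i₀ : Fin k) (q : ℕ) .{{_ : NonZero q}} (m : ℕ) (a : Fin k → ℕ)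
           (split : Splits m n a) (Σa≡q : sum a ≡ q) where

    private
      D : ℕ
      D = ⌈ sum n / q ⌉

      D≤1+m : D ≤ suc m
      D≤1+m = ⌈m/d⌉≤ q (suc m) (begin
        sum n                      ≤⟨ sum-mono-≤ (proj₂ ∘ split) ⟩
        sum (λ i → suc m * a i)    ≡⟨ *-distribˡ-sum (suc m) a ⟨
        suc m * sum a              ≡⟨ cong (suc m *_) Σa≡q ⟩
        suc m * q                  ≡⟨ *-comm (suc m) q ⟩
        q * suc m                  ∎)
        where open ≤-Reasoning

      m*q≤Σn : m * q ≤ sum n
      m*q≤Σn = begin
        m * q                 ≡⟨ cong (m *_) Σa≡q ⟨
        m * sum a             ≡⟨ *-distribˡ-sum m a ⟩
        sum (λ i → m * a i)   ≤⟨ sum-mono-≤ (proj₁ ∘ split) ⟩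
        sum n                 ∎
        where open ≤-Reasoning

      m≤D : m ≤ D
      m≤D = *-cancelˡ-≤ q (≤-trans (≤-reflexive (*-comm q m)) (≤-trans m*q≤Σn (m≤d*⌈m/d⌉ (sum n) q)))

      0<D : 0 < D
      0<D = n≢0⇒n>0 λ D≡0 → <⇒≱ (sum-mono-< {f = λ _ → 0} (λ _ → z≤n) i₀ (0<n i₀))
        (≤-trans (m≤d*⌈m/d⌉ (sum n) q)
        (≤-trans (≤-reflexive (trans (cong (q *_) D≡0) (*-zeroʳ q))) z≤n))

      -- If `D ≡ m`, the total is at most `m * q`, so no lower bound `m * a i ≤ n i` can be strict.
      tight : D ≡ m → ∀ i → n i ≤ m * a i
      tight D≡m i = ≮⇒≥ λ lt → <⇒≱ (sum-mono-< (proj₁ ∘ split) i lt) (begin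
        sum n                 ≤⟨ m≤d*⌈m/d⌉ (sum n) q ⟩
        q * D                 ≡⟨ *-comm q D ⟩
        D * q                 ≡⟨ cong₂ _*_ D≡m (sym Σa≡q) ⟩
        m * sum a             ≡⟨ *-distribˡ-sum m a ⟩
        sum (λ i → m * a i)   ∎)
        where open ≤-Reasoning

    -- When all classes have the same size m, then m = D and the same aᵢ also
    -- split into sizes D - 1 and D.
    split-at-mean : ∃ λ e → ⌈ sum n / q ⌉ ≡ suc e × Splits e n a
    split-at-mean with m≤n⇒m<n∨m≡n D≤1+m
    ... | inj₂ D≡1+m = m , D≡1+m , split
    ... | inj₁ D<1+m with ≤-antisym (s≤s⁻¹ D<1+m) m≤D
    ...   | D≡m = pred m , D≡1+e , λ i →
              ≤-trans (*-monoˡ-≤ (a i) (pred[n]≤n {m})) (proj₁ (split i)) ,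
              subst (λ z → n i ≤ z * a i) (trans (sym D≡m) D≡1+e) (tight D≡m i)
      where
      D≡1+e : D ≡ suc (pred m)
      D≡1+e = trans D≡m (sym (suc-pred m {{>-nonZero (subst (0 <_) D≡m 0<D)}}))

  module _ (q D : ℕ) (a : Fin k → ℕ) (split : Splits D n a) (Σa≡q : sum a ≡ q) where

    Σ⌈n/d⌉≤q : ∀ d .{{_ : NonZero d}} → D < d → sum (λ i → ⌈ n i / d ⌉) ≤ q
    Σ⌈n/d⌉≤q d D<d = ≤-trans
      (sum-mono-≤ λ i → ⌈m/d⌉≤ d (a i) (≤-trans (proj₂ (split i)) (*-monoˡ-≤ (a i) D<d)))
      (≤-reflexive Σa≡q)

    -- Induction on `e` down to `D`: the intervals for successive class sizes are glued together.
    -- The last one is capped at `a`, whose sum is `q`.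
    colorings : ∀ {e} → D ≤′ e →
                (∀ d .{{_ : NonZero d}} → D < d → d ≤ e → ¬ (TwoNonMultiples n d ⊎ LargeQuotient n d)) →
                ∀ r → sum (λ i → ⌈ n i / suc e ⌉) ≤ r → r ≤ q →
                EquitableColoring (completeMultipartite n) r
    colorings (≤′-reflexive refl) below r Σ≤r r≤q =
      coloring-between D n _ a 0<n (λ i → ⌈m/d⌉≤ (suc D) (a i) (proj₂ (split i))) (proj₁ ∘ split)
        (λ i → m≤d*⌈m/d⌉ (n i) (suc D)) r Σ≤r (≤-trans r≤q (≤-reflexive (sym Σa≡q)))
    colorings {suc e} (≤′-step D≤e) below r Σ≤r r≤q with sum (λ i → ⌈ n i / suc e ⌉) ≤? r
    ... | yes Σ′≤r = colorings D≤e (λ d D<d d≤e → below d D<d (m≤n⇒m≤1+n d≤e)) r Σ′≤r r≤q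
    -- Now `r` is below the sum of ceilings for `suc e`, hence by contiguity at most the sum of
    -- floors, and sizes `suc e` and `suc (suc e)` suffice.
    ... | no Σ′≰r  =
      coloring-between (suc e) n _ (λ i → n i / suc e) 0<n
        (λ i → ⌈m/d⌉≤ (suc (suc e)) (n i / suc e) (belowThreshold⇒nonempty (suc e) (notYet ∘ inj₂) i))
        (λ i → d*[m/d]≤m (n i) (suc e)) (λ i → m≤d*⌈m/d⌉ (n i) (suc (suc e))) r Σ≤r
        (s≤s⁻¹ (≤-trans (≰⇒> Σ′≰r) (belowThreshold⇒contiguous (suc e) (notYet ∘ inj₁))))
      where
      notYet : ¬ (TwoNonMultiples n (suc e) ⊎ LargeQuotient n (suc e))
      notYet = below (suc e) (s≤s (≤′⇒≤ D≤e)) ≤-refl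

-- The least starting point

leastThreshold⇒leastStart :
  (n : Fin (suc (suc k)) → ℕ) → (∀ i → 0 < n i) → (q : ℕ) .{{_ : NonZero q}} →
  EquitableColoring (completeMultipartite n) q →
  ∀ d .{{_ : NonZero d}} → IsLeast (Threshold n q) d →
  IsLeast
    (λ s → 0 < s × s ≤ q ×
      (∀ r → s ≤ r → r ≤ q → EquitableColoring (completeMultipartite n) r))
    (sum λ i → ⌈ n i / d ⌉)
leastThreshold⇒leastStart n 0<n q coloring (suc e) ((_ , D≤d , th) , least-d)
  with m , a , split₀ , Σa≡q ← coloring⇒split zero n coloring
  -- From here `D` is one less than the ceiling of the mean class size, so `D < d` expresses the
  -- lower bound on `d` in `Threshold`.
  with D , D≡ , split ← split-at-mean n 0<n zero q m a split₀ Σa≡q =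
  (positive , Σ⌈n/d⌉≤q n 0<n q D a split Σa≡q (suc e) D<d ,
    colorings n 0<n q D a split Σa≡q (≤⇒≤′ (s≤s⁻¹ D<d)) below) ,
  minimal
  where
  P : ℕ
  P = sum λ i → ⌈ n i / suc e ⌉

  D<d : D < suc e
  D<d = subst (_≤ suc e) D≡ D≤d

  positive : 0 < P
  positive = ≤-trans (s≤s z≤n) (sum-mono-< {f = λ _ → 0} {λ i → ⌈ n i / suc e ⌉} (λ _ → z≤n) zero
    (n≢0⇒n>0 λ ⌈n₀/d⌉≡0 → n≮0 (≤-trans (0<n zero) (≤-trans (m≤d*⌈m/d⌉ (n zero) (suc e))
      (≤-reflexive (trans (cong (suc e *_) ⌈n₀/d⌉≡0) (*-zeroʳ (suc e))))))))

  below : ∀ d .{{_ : NonZero d}} → D < d → d ≤ e → ¬ (TwoNonMultiples n d ⊎ LargeQuotient n d)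
  below d@(suc _) D<d d≤e th = 1+n≰n (≤-trans (least-d d (_ , subst (_≤ d) (sym D≡) D<d , th)) d≤e)

  minimal : ∀ s → (0 < s × s ≤ q ×
              (∀ r → s ≤ r → r ≤ q → EquitableColoring (completeMultipartite n) r)) → P ≤ s
  minimal s (0<s , _ , colorable) = ≮⇒≥ λ s<P →
    -- A start `s` below `P` would put `r = pred P` in the range, but no splitting has that total.
    let 1+r≡P : suc (pred P) ≡ P
        1+r≡P = suc-pred P {{>-nonZero (≤-trans 0<s (<⇒≤ s<P))}}
        s≤r = s≤s⁻¹ (≤-trans s<P (≤-reflexive (sym 1+r≡P)))
        r≤q = ≤-trans pred[n]≤n (Σ⌈n/d⌉≤q n 0<n q D a split Σa≡q (suc e) D<d)
        mᵣ , aᵣ , splitᵣ , Σ≡r = coloring⇒split {{>-nonZero (≤-trans 0<s s≤r)}} zero n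
                                              (colorable (pred P) s≤r r≤q)
    in threshold⇒gap n 0<n zero (suc zero) (λ ()) (suc e) th mᵣ aᵣ splitᵣ (trans (cong suc Σ≡r) 1+r≡P)

theorem3 : (k : ℕ) .{{_ : NonTrivial k}} (n : Fin k → ℕ) → (∀ i → 0 < n i) →
    (q : ℕ) .{{_ : NonZero q}} →
    EquitableColoring (completeMultipartite n) q →
    IsLeast
    (λ s → 0 < s × s ≤ q ×
    (∀ r → s ≤ r → r ≤ q → EquitableColoring (completeMultipartite n) r))
    (p q n)
-- Matching on `k ≥ 2` provides the two distinct indices used for the gap.
theorem3 (suc (suc k)) n 0<n q coloring =
  leastThreshold⇒leastStart n 0<n q coloring (d q n) {{d≢0 q n}} (proj₂ (leastThreshold q n))
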